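{- Let $n$ and $\ell$ be positive integers satisfying $7\leq \ell\leq \frac{n-1}{2}$. Then $$t(n,3,\ell)\leq n+t+\binom{t}{2}\Big(n-2-\Big\lfloor\frac{n-2}{\ell-3}\Big\rfloor(\ell-3)\Big)+\binom{t+\big\lfloor\frac{n-2}{\ell-3}\big\rfloor-\big\lceil\frac{n-2}{\ell-3}\big\rceil}{2}\Big(\ell+1-n+\Big\lfloor\frac{n-2}{\ell-3}\Big\rfloor(\ell-3)\Big),$$ where on the right-hand side $t$ denotes the integer $t=\big\lceil\frac{n-2}{\ell-3}\big\rceil$.
   Context: All graphs are finite, undirected and simple. Let $G$ be a nontrivial connected graph of order $n$ (i.e. with $n$ vertices). An edge-coloring of $G$ is any assignment of colors to the edges (adjacent edges may receive the same color). A tree $T$ that is a subgraph of $G$ is a rainbow tree if no two edges of $T$ have the same color. For $S\subseteq V(G)$ with $|S|\geq 2$, a rainbow $S$-tree is a rainbow tree $T$ in $G$ with $S\subseteq V(T)$. For an integer $k$ with $2\leq k\leq n$, an edge-coloring of $G$ is a $k$-rainbow coloring if for every $k$-subset $S$ of $V(G)$ there exists a rainbow $S$-tree. The $k$-rainbow index $rx_k(G)$ is the minimum number of colors needed in a $k$-rainbow coloring of $G$. For integers $2\leq k\leq n$ and $2\leq\ell\leq n-1$, $t(n,k,\ell)$ denotes the minimum size (number of edges) of a connected graph $G$ of order $n$ with $rx_k(G)\leq \ell$ (when such a graph exists). The function $t(\cdot,\cdot,\cdot)$ is not to be confused with the integer $t$ in the claim. -}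

module Defs where

open import Data.Bool.Base using (Bool; false; T)
open import Data.Bool.Properties using (T?)
open import Data.Fin.Base using (Fin) renaming (_<_ to _<ᶠ_)
open import Data.Fin.Properties using () renaming (_<?_ to _<ᶠ?_)
open import Data.Fin.Subset using (Subset; _∈_; _⊆_; ∣_∣)
open import Data.List.Base using (List; _∷_; _∷ʳ_; length; filter; allFin; cartesianProduct)
open import Data.List.Relation.Unary.Linked using (Linked)
open import Data.List.Relation.Unary.Unique.Propositional using (Unique)
open import Data.Nat.Base using (ℕ; zero; suc; _+_; _∸_; _≤_; s≤s; NonZero)
open import Data.Nat.DivMod using (_/_)
open import Data.Product.Base using (_×_; _,_; ∃; ∃-syntax)
open import Data.Sum.Base using (_⊎_)
open import Relation.Binary.Construct.Closure.ReflexiveTransitive using (Star)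
open import Relation.Binary.PropositionalEquality.Core using (_≡_)
open import Relation.Nullary.Decidable.Core using (_×-dec_)
open import Relation.Nullary.Negation.Core using (¬_)

record Graph (n : ℕ) : Set where
  field
    adj    : Fin n → Fin n → Bool
    sym    : ∀ u v → adj u v ≡ adj v u
    irrefl : ∀ u → adj u u ≡ false

  Adj : Fin n → Fin n → Set
  Adj u v = T (adj u v)

open Graph public using (Adj)

-- Each edge {u , v} is listed once, as the pair with u < v.
edges : ∀ {n} → Graph n → List (Fin n × Fin n)
edges {n} G =
  filter (λ (u , v) → (u <ᶠ? v) ×-dec T? (Graph.adj G u v))
         (cartesianProduct (allFin n) (allFin n))

size : ∀ {n} → Graph n → ℕ
size G = length (edges G)

Connected : ∀ {n} → Graph n → Set
Connected G = ∀ u v → Star (Adj G) u v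

-- The closed walk u, vs, u is a cycle when u ∷ vs has at least three
-- vertices, all distinct.
IsCycle : ∀ {n} → Graph n → Fin n → List (Fin n) → Set
IsCycle G u vs =
  2 ≤ length vs × Unique (u ∷ vs) × Linked (Adj G) (u ∷ (vs ∷ʳ u))

Acyclic : ∀ {n} → Graph n → Set
Acyclic G = ∀ u vs → ¬ IsCycle G u vs

-- The edges of a subgraph of G are kept as a graph on all n vertices of G
-- in which the vertices outside `verts` are isolated.
record Subgraph {n : ℕ} (G : Graph n) : Set where
  field
    verts    : Subset n
    graph    : Graph n
    sub      : ∀ {u v} → Adj graph u v → Adj G u v
    incident : ∀ {u v} → Adj graph u v → u ∈ verts × v ∈ verts

open Subgraph public using (verts; graph)

-- Walks in `graph H` starting in `verts H` stay there, by `incident`.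
IsTree : ∀ {n} {G : Graph n} → Subgraph G → Set
IsTree H =
  (∀ {u v} → u ∈ verts H → v ∈ verts H → Star (Adj (graph H)) u v)
  × Acyclic (graph H)

-- A colouring of the edges of G with colours from a set of size c.  It is
-- total on pairs of vertices, but only its values on edges are ever used.
record EdgeColoring {n : ℕ} (G : Graph n) (c : ℕ) : Set where
  field
    color : Fin n → Fin n → Fin c
    sym   : ∀ {u v} → Adj G u v → color u v ≡ color v u

open EdgeColoring public using (color)

module _ {n c : ℕ} {G : Graph n} (χ : EdgeColoring G c) where

  -- Two edges of the same colour are equal as unordered pairs.
  IsRainbow : Subgraph G → Set
  IsRainbow H =
    ∀ {u v x y} → Adj (graph H) u v → Adj (graph H) x y →
    color χ u v ≡ color χ x y → (u ≡ x × v ≡ y) ⊎ (u ≡ y × v ≡ x)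

  IsRainbowTree : Subset n → Subgraph G → Set
  IsRainbowTree S H = IsTree H × IsRainbow H × S ⊆ verts H

  IsRainbowColoring : ℕ → Set
  IsRainbowColoring k = ∀ (S : Subset n) → ∣ S ∣ ≡ k → ∃ (IsRainbowTree S)

IsMinimum : (ℕ → Set) → ℕ → Set
IsMinimum P m = P m × (∀ j → P j → m ≤ j)

-- rx_k(G) = c
RainbowIndex : ∀ {n} → Graph n → ℕ → ℕ → Set
RainbowIndex G k =
  IsMinimum (λ c → ∃ λ (χ : EdgeColoring G c) → IsRainbowColoring χ k)

-- t(n, k, ℓ) = m
MinimumSize : ℕ → ℕ → ℕ → ℕ → Set
MinimumSize n k ℓ =
  IsMinimum (λ m → ∃ λ (G : Graph n) →
    Connected G × (∃[ c ] RainbowIndex G k c × c ≤ ℓ) × size G ≡ m)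

⌊_/_⌋ : (a d : ℕ) .{{_ : NonZero d}} → ℕ
⌊ a / d ⌋ = a / d

⌈_/_⌉ : (a d : ℕ) .{{_ : NonZero d}} → ℕ
⌈ a / d ⌉ = (a + (d ∸ 1)) / d

ℓ∸3-nonZero : ∀ {ℓ} → 7 ≤ ℓ → NonZero (ℓ ∸ 3)
ℓ∸3-nonZero (s≤s (s≤s (s≤s (s≤s _)))) = _

{-# OPTIONS --safe #-}
-- Put d = ℓ - 3.  Join a centre to n - 1 further vertices 0, …, n - 2, and make
-- each residue class modulo d a clique.  The edge from the centre to i gets
-- one of d colours according to i mod d; the edge between i < j in one class gets one
-- of three further colours according to the parities of i / d and j / d: one
-- colour if they agree, and one each for even–odd and odd–even.  A rainbow tree
-- for vertices in different classes uses a spoke for each class and at most one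
-- clique edge.  Within a class, three vertices a < b < c lie on the path a, b, c,
-- which is rainbow unless the three parities agree; in that case the path
-- a, a + d, b, c uses all three clique colours.
--
-- The graph has n - 1 + Σ_{j < n - 1} ⌊j / d⌋ edges, which is within the bound.
-- The minimum t(n, 3, ℓ) exists because there are finitely many graphs,
-- colourings and subgraphs, and all the properties involved are decidable.
module Submission where

open import Data.Bool.Base using (Bool; true; false; T; not; _∧_)
open import Data.Bool.Properties using (T?; T-∧; not-¬) renaming (_≟_ to _≟ᵇ_)
open import Data.Empty using (⊥)
open import Data.Fin.Base as Fin using (Fin; zero; suc; toℕ; fromℕ<; _↑ˡ_; _↑ʳ_)
open import Data.Fin.Properties
  using ( _≟_; _<?_; any?; all?; injective⇒≤; toℕ-injective; toℕ<n; toℕ-fromℕ<; ↑ˡ-injective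
        ; ↑ʳ-injective; suc-injective
        )
open import Data.Fin.Subset using (Subset; inside; outside; _∪_; ⁅_⁆; ∣_∣) renaming (_∈_ to _∈ₛ_)
open import Data.Fin.Subset.Properties
  using ( anySubset?; _∈?_; _⊆?_; x∈⁅x⁆; x∈⁅y⁆⇒x≡y; x∈p∪q⁻; p⊆p∪q; q⊆p∪q
        )
open import Data.List.Base
  using ( List; []; _∷_; [_]; _∷ʳ_; _++_; length; lookup; map; filter; tabulate; allFin; applyUpTo
        ; cartesianProduct
        )
open import Data.List.Membership.Propositional using (_∈_; _∉_)
open import Data.List.Membership.Propositional.Properties using (∈-lookup; ∈-allFin; ∈-∃++; ∈-map⁺)
open import Data.List.Properties
  using ( ++-assoc; filter-++; filter-≐; length-++; length-++-comm; length-map; map-tabulate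
        ; applyUpTo-∷ʳ
        )
import Data.List.Relation.Binary.Permutation.Setoid.Properties as Permutation
open import Data.List.Relation.Unary.All as All using (All; []; _∷_)
import Data.List.Relation.Unary.All.Properties as All
open import Data.List.Relation.Unary.AllPairs as AllPairs using (AllPairs; []; _∷_)
import Data.List.Relation.Unary.AllPairs.Properties as AllPairs
open import Data.List.Relation.Unary.Any using (here; there)
open import Data.List.Relation.Unary.Linked as Linked using (Linked; []; [-]; _∷_; linked?)
import Data.List.Relation.Unary.Unique.DecPropositional as DecUnique
open import Data.List.Relation.Unary.Unique.Propositional using (Unique)
open import Data.Nat.Base
  using ( ℕ; zero; suc; _+_; _*_; _∸_; _⊓_; _⊔_; _≤_; _<_; _<ᵇ_; z≤n; s≤s; s≤s⁻¹; NonZero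
        )
open import Data.Nat.Combinatorics using (_C_; nCk+nC[k+1]≡[n+1]C[k+1]; nC1≡n)
open import Data.Nat.Divisibility using (_∣_; _∣?_; divides; ∣-refl)
open import Data.Nat.DivMod
  using ( _/_; _%_; m≡m%n+[m/n]*n; m%n≡m∸m/n*n; m%n<n; [m+n]%n≡m%n; n/n≡1; m*n/n≡m; m<n⇒m/n≡0
        ; m<n*o⇒m/o<n; /-monoˡ-≤; +-distrib-/-∣ʳ
        )
open import Data.Nat.Induction using (<-rec)
open import Data.Nat.ListAction using (sum)
open import Data.Nat.ListAction.Properties using (sum-++)
import Data.Nat.Properties as ℕ
open import Data.Nat.Tactic.RingSolver using (solve-∀)
open import Data.Product.Base using (_×_; _,_; ∃; ∃₂; ∃-syntax; proj₁; proj₂)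
open import Data.Sum.Base as Sum using (_⊎_; inj₁; inj₂; [_,_]′)
open import Data.Unit.Base using (⊤; tt)
open import Data.Vec.Base as Vec using ([]; _∷_)
open import Function.Base using (_∘_; id)
open import Function.Bundles using (mk⇔; Equivalence)
open import Level using (0ℓ)
open import Relation.Binary.Construct.Closure.ReflexiveTransitive as Star using (Star; ε; _◅_; _◅◅_)
open import Relation.Binary.Core using (Rel)
open import Relation.Binary.Definitions
  using ( Reflexive; Symmetric; _Respects_
        ) renaming (Decidable to Decidable₂)
open import Relation.Binary.PropositionalEquality
  using ( _≡_; _≢_; refl; sym; trans; cong; cong₂; subst; ≢-sym; setoid; module ≡-Reasoning
        )
open import Relation.Nullary.Decidable
  using ( Dec; yes; no; does; map′; ¬?; _×-dec_; _⊎-dec_; _→-dec_; decidable-stable; does-⇔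
        ; dec-false
        )
open import Relation.Nullary.Negation using (¬_; contradiction)
open import Relation.Unary using (Decidable)

open import Defs

-- Decidability

-- Descend from `m`: a bounded search either finds a smaller witness to recurse on or shows that `m`
-- is itself the minimum.
least : ∀ {P : ℕ → Set} → Decidable P → ∀ {m} → P m → ∃ λ k → IsMinimum P k × k ≤ m
least {P} P? {m} = <-rec (λ m → P m → ∃ λ k → IsMinimum P k × k ≤ m) step m
  where
  step : ∀ m → (∀ {j} → j < m → P j → ∃ λ k → IsMinimum P k × k ≤ j) →
         P m → ∃ λ k → IsMinimum P k × k ≤ m
  step m rec Pm with ℕ.anyUpTo? P? m
  ... | yes (j , j<m , Pj) = let k , min , k≤j = rec j<m Pj in k , min , ℕ.≤-trans k≤j (ℕ.<⇒≤ j<m)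
  ... | no none = m , (Pm , λ j Pj → ℕ.≮⇒≥ (λ j<m → none (j , j<m , Pj))) , ℕ.≤-refl

-- Existential quantification over A preserves decidability, for predicates
-- that respect _≈_; without function extensionality this restriction is
-- needed for function types.
Searchable : ∀ {A : Set} → Rel A 0ℓ → Set₁
Searchable {A} _≈_ = ∀ {P : A → Set} → P Respects _≈_ → Decidable P → Dec (∃ P)

searchBool : Searchable {Bool} _≡_
searchBool _ P? = map′ [ (λ p → true , p) , (λ p → false , p) ]′
  (λ { (true , p) → inj₁ p ; (false , p) → inj₂ p })
  (P? true ⊎-dec P? false)

searchFin : ∀ {n} → Searchable {Fin n} _≡_
searchFin _ = any?

cons : ∀ {A : Set} {n} → A → (Fin n → A) → Fin (suc n) → A
cons a f zero    = a
cons a f (suc i) = f i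

-- Induction on the domain: search for the first value, then for the rest. A function agrees with
-- the `cons` of its parts only pointwise, which is where `resp` enters.
searchFunction : ∀ {A : Set} {_≈_ : Rel A 0ℓ} → Reflexive _≈_ → Searchable _≈_ →
                 ∀ {n} → Searchable {Fin n → A} (λ f g → ∀ i → f i ≈ g i)
searchFunction ≈-refl search {zero} resp P? =
  map′ (_ ,_) (λ { (f , p) → resp (λ ()) p }) (P? λ ())
searchFunction ≈-refl search {suc n} {P} resp P? =
  map′ (λ { (a , f , p) → cons a f , p })
       (λ { (f , p) → f zero , f ∘ suc , resp (λ { zero → ≈-refl ; (suc i) → ≈-refl }) p })
       (search {λ a → ∃ λ f → P (cons a f)}
         (λ { a≈b (f , p) → f , resp (λ { zero → a≈b ; (suc i) → ≈-refl }) p })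
         λ a → searchFunction ≈-refl search
           (λ f≈g → resp λ { zero → ≈-refl ; (suc i) → f≈g i })
           (P? ∘ cons a))

searchMatrix : ∀ {A : Set} → Searchable {A} _≡_ → ∀ {m n} →
               Searchable {Fin m → Fin n → A} (λ f g → ∀ i j → f i j ≡ g i j)
searchMatrix search = searchFunction (λ _ → refl) (searchFunction refl search)

anyList? : ∀ {n} m {P : List (Fin n) → Set} → Decidable P → Dec (∃ λ xs → length xs ≤ m × P xs)
anyList? zero P? = map′ (λ p → [] , z≤n , p) (λ { ([] , _ , p) → p }) (P? [])
anyList? (suc m) P? =
  map′ [ (λ p → [] , z≤n , p) , (λ { (x , xs , xs≤m , p) → x ∷ xs , s≤s xs≤m , p }) ]′
       (λ { ([] , _ , p) → inj₁ p ; (x ∷ xs , s≤s xs≤m , p) → inj₂ (x , xs , xs≤m , p) })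
       (P? [] ⊎-dec any? λ x → anyList? m (P? ∘ (x ∷_)))

allSubset? : ∀ {n} {P : Subset n → Set} → Decidable P → Dec (∀ S → P S)
allSubset? P? =
  map′ (λ none S → decidable-stable (P? S) λ ¬p → none (S , ¬p))
       (λ all (S , ¬p) → ¬p (all S))
       (¬? (anySubset? (¬? ∘ P?)))

lookup-injective : ∀ {A : Set} {xs : List A} → Unique xs → ∀ i j → lookup xs i ≡ lookup xs j → i ≡ j
lookup-injective (x≢ ∷ _) zero    zero    _  = refl
lookup-injective (x≢ ∷ _) zero    (suc j) eq = contradiction eq (All.lookup x≢ (∈-lookup j))
lookup-injective (x≢ ∷ _) (suc i) zero    eq = contradiction (sym eq) (All.lookup x≢ (∈-lookup i))
lookup-injective (_ ∷ u)  (suc i) (suc j) eq = cong suc (lookup-injective u i j eq)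

unique⇒length≤ : ∀ {n} {xs : List (Fin n)} → Unique xs → length xs ≤ n
unique⇒length≤ u = injective⇒≤ (lookup-injective u _ _)

-- Warshall's algorithm: `Via ps u v` is reachability through the pivots ps.
module _ {n} {R : Rel (Fin n) 0ℓ} (R? : Decidable₂ R) where

  Via : List (Fin n) → Fin n → Fin n → Set
  Via []       u v = u ≡ v ⊎ R u v
  Via (p ∷ ps) u v = Via ps u v ⊎ Via ps u p × Via ps p v

  via? : ∀ ps u v → Dec (Via ps u v)
  via? []       u v = u ≟ v ⊎-dec R? u v
  via? (p ∷ ps) u v = via? ps u v ⊎-dec via? ps u p ×-dec via? ps p v

  via⇒star : ∀ ps {u v} → Via ps u v → Star R u v
  via⇒star []       (inj₁ refl)    = ε
  via⇒star []       (inj₂ r)       = r ◅ ε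
  via⇒star (p ∷ ps) (inj₁ x)       = via⇒star ps x
  via⇒star (p ∷ ps) (inj₂ (x , y)) = via⇒star ps x ◅◅ via⇒star ps y

  via-base : ∀ ps {u v} → u ≡ v ⊎ R u v → Via ps u v
  via-base []       x = x
  via-base (p ∷ ps) x = inj₁ (via-base ps x)

  -- If `w` is the newest pivot, each half is cut where it meets `w`. Otherwise `w` is an older
  -- pivot; when both halves pass through `p`, the detour from `p` to `w` and back is dropped.
  via-trans : ∀ ps {u w v} → w ∈ ps → Via ps u w → Via ps w v → Via ps u v
  via-trans (p ∷ ps) (here refl) x y =
    inj₂ ([ id , proj₁ ]′ x , [ id , proj₂ ]′ y)
  via-trans (p ∷ ps) (there w∈) (inj₁ x)        (inj₁ y)        = inj₁ (via-trans ps w∈ x y)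
  via-trans (p ∷ ps) (there w∈) (inj₁ x)        (inj₂ (y , y′)) = inj₂ (via-trans ps w∈ x y , y′)
  via-trans (p ∷ ps) (there w∈) (inj₂ (x , x′)) (inj₁ y)        = inj₂ (x , via-trans ps w∈ x′ y)
  via-trans (p ∷ ps) (there w∈) (inj₂ (x , x′)) (inj₂ (y , y′)) = inj₂ (x , y′)

  -- With every vertex a pivot, `via-trans` applies at each intermediate vertex of the walk.
  star⇒via : ∀ {u v} → Star R u v → Via (allFin n) u v
  star⇒via ε        = via-base (allFin n) (inj₁ refl)
  star⇒via (r ◅ rs) = via-trans (allFin n) (∈-allFin _) (via-base (allFin n) (inj₂ r)) (star⇒via rs)

  star? : ∀ u v → Dec (Star R u v)
  star? u v = map′ (via⇒star (allFin n)) star⇒via (via? (allFin n) u v)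

adj? : ∀ {n} (G : Graph n) u v → Dec (Adj G u v)
adj? G u v = T? (Graph.adj G u v)

connected? : ∀ {n} (G : Graph n) → Dec (Connected G)
connected? G = all? λ u → all? λ v → star? (adj? G) u v

-- The vertices of a cycle are distinct, so by the pigeonhole principle only lists of length at most
-- `n` have to be searched.
acyclic? : ∀ {n} (G : Graph n) → Dec (Acyclic G)
acyclic? {n} G =
  map′ (λ none u vs c → none (u , vs , length≤ c , c))
       (λ acyclic (u , vs , _ , c) → acyclic u vs c)
       (¬? (any? λ u → anyList? n λ vs →
         2 ℕ.≤? length vs ×-dec unique? (u ∷ vs) ×-dec linked? (adj? G) (u ∷ (vs ∷ʳ u))))
  where
  open DecUnique (_≟_ {n}) using (unique?)
  length≤ : ∀ {u vs} → IsCycle G u vs → length vs ≤ n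
  length≤ (_ , u , _) = ℕ.<⇒≤ (unique⇒length≤ u)

isTree? : ∀ {n} {G : Graph n} (H : Subgraph G) → Dec (IsTree H)
isTree? H =
  map′ (λ f {u} {v} → f u v) (λ f u v → f)
    (all? λ u → all? λ v → u ∈? verts H →-dec v ∈? verts H →-dec star? (adj? (graph H)) u v)
  ×-dec acyclic? (graph H)

-- Search over graphs, subgraphs and colourings up to pointwise equality

infix 4 _≈_
-- A record, so that `G` and `H` can be inferred from a proof; the bare equations on `adj` do not
-- determine them.
record _≈_ {n} (G H : Graph n) : Set where
  constructor pointwise
  field adj≡ : ∀ u v → Graph.adj G u v ≡ Graph.adj H u v

≈-refl : ∀ {n} {G : Graph n} → G ≈ G
≈-refl = pointwise λ _ _ → refl

≈-sym : ∀ {n} {G H : Graph n} → G ≈ H → H ≈ G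
≈-sym (pointwise p) = pointwise λ u v → sym (p u v)

≈-trans : ∀ {n} {G H K : Graph n} → G ≈ H → H ≈ K → G ≈ K
≈-trans (pointwise p) (pointwise q) = pointwise λ u v → trans (p u v) (q u v)

≈-adj : ∀ {n} {G H : Graph n} → G ≈ H → ∀ {u v} → Adj G u v → Adj H u v
≈-adj G≈H = subst T (_≈_.adj≡ G≈H _ _)

≈-acyclic : ∀ {n} {G H : Graph n} → G ≈ H → Acyclic G → Acyclic H
≈-acyclic G≈H acyclic u vs (len , uniq , linked) =
  acyclic u vs (len , uniq , Linked.map (≈-adj (≈-sym G≈H)) linked)

-- Search the adjacency matrices. A matrix comes from a graph exactly when it is symmetric with a
-- false diagonal, and since `P` respects `_≈_`, testing one graph per matrix suffices. Subgraphs
-- and colourings below follow the same scheme.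
searchGraph : ∀ {n} → Searchable {Graph n} _≈_
searchGraph {n} {P} resp P? =
  map′ (λ { (_ , G , _ , p) → G , p }) (λ { (G , p) → _ , G , (λ _ _ → refl) , p })
    (searchMatrix searchBool
      (λ { f≗g (G , G≗f , p) → G , (λ u v → trans (G≗f u v) (f≗g u v)) , p })
      extends?)
  where
  extends? : ∀ f → Dec (∃ λ G → (∀ u v → Graph.adj G u v ≡ f u v) × P G)
  extends? f with all? (λ u → all? λ v → f u v ≟ᵇ f v u) ×-dec all? (λ u → f u u ≟ᵇ false)
  ... | no  ¬graph = no λ { (G , G≗f , _) → ¬graph
    ( (λ u v → trans (sym (G≗f u v)) (trans (Graph.sym G u v) (G≗f v u)))
    , (λ u → trans (sym (G≗f u u)) (Graph.irrefl G u))) }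
  ... | yes (s , i) = map′ (λ p → G , (λ _ _ → refl) , p)
                           (λ { (_ , H≗f , p) → resp (pointwise H≗f) p }) (P? G)
    where G = record { adj = f ; sym = s ; irrefl = i }

searchSubgraph : ∀ {n} {G : Graph n} →
                 Searchable {Subgraph G} (λ H K → verts H ≡ verts K × graph H ≈ graph K)
searchSubgraph {n} {G} {P} resp P? =
  map′ (λ { (_ , _ , H , _ , p) → H , p })
       (λ { (H , p) → verts H , graph H , H , (refl , ≈-refl) , p })
    (anySubset? λ V → searchGraph
      (λ { E≈F (H , (≡V , ≈E) , p) → H , (≡V , ≈-trans ≈E E≈F) , p })
      (extends? V))
  where
  extends? : ∀ V E → Dec (∃ λ H → (verts H ≡ V × graph H ≈ E) × P H)
  extends? V E with (all? λ u → all? λ v → adj? E u v →-dec adj? G u v)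
                  ×-dec (all? λ u → all? λ v → adj? E u v →-dec (u ∈? V ×-dec v ∈? V))
  ... | no  ¬sub = no λ { (H , (refl , ≈E) , _) →
    let back = λ {u} {v} → ≈-adj (≈-sym ≈E) {u} {v} in
    ¬sub ((λ u v e → Subgraph.sub H (back e)) , (λ u v e → Subgraph.incident H (back e))) }
  ... | yes (s , i) = map′ (λ p → H , (refl , ≈-refl) , p) (λ { (_ , K≈H , p) → resp K≈H p }) (P? H)
    where
    H : Subgraph G
    H = record { verts = V ; graph = E ; sub = s _ _ ; incident = i _ _ }

searchColoring : ∀ {n c} {G : Graph n} →
                 Searchable {EdgeColoring G c} (λ χ ψ → ∀ u v → color χ u v ≡ color ψ u v)
searchColoring {n} {c} {G} {P} resp P? =
  map′ (λ { (_ , χ , _ , p) → χ , p }) (λ { (χ , p) → _ , χ , (λ _ _ → refl) , p })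
    (searchMatrix searchFin
      (λ { f≗g (χ , χ≗f , p) → χ , (λ u v → trans (χ≗f u v) (f≗g u v)) , p })
      extends?)
  where
  extends? : ∀ f → Dec (∃ λ χ → (∀ u v → color χ u v ≡ f u v) × P χ)
  extends? f with all? (λ u → all? λ v → adj? G u v →-dec f u v ≟ f v u)
  ... | no  ¬sym = no λ { (χ , χ≗f , _) → ¬sym λ u v e →
                     trans (sym (χ≗f u v)) (trans (EdgeColoring.sym χ e) (χ≗f v u)) }
  ... | yes s = map′ (λ p → χ , (λ _ _ → refl) , p) (λ { (_ , ≗χ , p) → resp ≗χ p }) (P? χ)
    where
    χ : EdgeColoring G c
    χ = record { color = f ; sym = s _ _ }

module _ {n c : ℕ} {G : Graph n} where

  isRainbow? : (χ : EdgeColoring G c) (H : Subgraph G) → Dec (IsRainbow χ H)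
  isRainbow? χ H =
    map′ (λ f {u} {v} {x} {y} → f u v x y) (λ f u v x y → f {u} {v} {x} {y})
      (all? λ u → all? λ v → all? λ x → all? λ y →
        adj? (graph H) u v →-dec adj? (graph H) x y →-dec
        color χ u v ≟ color χ x y →-dec
        ((u ≟ x ×-dec v ≟ y) ⊎-dec (u ≟ y ×-dec v ≟ x)))

  ≈-isRainbowTree : (χ : EdgeColoring G c) (S : Subset n) →
    IsRainbowTree χ S Respects (λ H K → verts H ≡ verts K × graph H ≈ graph K)
  ≈-isRainbowTree χ S {H} {K} (refl , H≈K) ((connected , acyclic) , rainbow , S⊆) =
    ( (λ u∈ v∈ → Star.map (≈-adj H≈K) (connected u∈ v∈))
    , ≈-acyclic H≈K acyclic)
    , (λ e e′ → rainbow (back e) (back e′)) , S⊆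
    where
    back : ∀ {u v} → Adj (graph K) u v → Adj (graph H) u v
    back = ≈-adj (≈-sym H≈K)

  isRainbowColoring? : (χ : EdgeColoring G c) → ∀ k → Dec (IsRainbowColoring χ k)
  isRainbowColoring? χ k = allSubset? λ S → ∣ S ∣ ℕ.≟ k →-dec
    searchSubgraph {G = G} (λ {H} {K} → ≈-isRainbowTree χ S {H} {K})
      (λ H → isTree? H ×-dec isRainbow? χ H ×-dec S ⊆? verts H)

  ≗-isRainbowColoring : ∀ k → (λ (χ : EdgeColoring G c) → IsRainbowColoring χ k)
    Respects (λ χ ψ → ∀ u v → color χ u v ≡ color ψ u v)
  ≗-isRainbowColoring k χ≗ψ rainbow S ∣S∣≡k =
    let H , tree , inj , S⊆ = rainbow S ∣S∣≡k in
    H , tree , (λ e e′ eq → inj e e′ (trans (χ≗ψ _ _) (trans eq (sym (χ≗ψ _ _))))) , S⊆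

-- Existence of the rainbow index and of the minimum size

Colorable : ∀ {n} → Graph n → ℕ → ℕ → Set
Colorable G k c = ∃ λ (χ : EdgeColoring G c) → IsRainbowColoring χ k

colorable? : ∀ {n} (G : Graph n) k c → Dec (Colorable G k c)
colorable? G k c = searchColoring {G = G} (λ {χ} {ψ} → ≗-isRainbowColoring k {χ} {ψ}) λ χ → isRainbowColoring? χ k

≈-colorable : ∀ {n} {G H : Graph n} → G ≈ H → ∀ {k c} → Colorable G k c → Colorable H k c
≈-colorable G≈H (χ , rainbow) =
  record { color = color χ ; sym = λ e → EdgeColoring.sym χ (≈-adj (≈-sym G≈H) e) } ,
  λ S ∣S∣≡k → let K , tree , inj , S⊆ = rainbow S ∣S∣≡k in
    record { verts = verts K ; graph = graph K
           ; sub = λ e → ≈-adj G≈H (Subgraph.sub K e) ; incident = Subgraph.incident K } ,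
    tree , (λ {u} {v} {x} {y} → inj {u} {v} {x} {y}) , S⊆

≈-size : ∀ {n} {G H : Graph n} → G ≈ H → size G ≡ size H
≈-size {n} {G} {H} G≈H = cong length (filter-≐ _ _
  ( (λ (u<v , e) → u<v , ≈-adj G≈H e)
  , (λ (u<v , e) → u<v , ≈-adj (≈-sym G≈H) e))
  (cartesianProduct (allFin n) (allFin n)))

colorable⇒rainbowIndex : ∀ {n} (G : Graph n) {k ℓ} → Colorable G k ℓ → ∃[ c ] RainbowIndex G k c × c ≤ ℓ
colorable⇒rainbowIndex G {k} = least (colorable? G k)

minimumSize : ∀ {n k ℓ} (G : Graph n) → Connected G → Colorable G k ℓ →
              ∃[ m ] (MinimumSize n k ℓ m × m ≤ size G)
minimumSize {n} {k} {ℓ} G connected colorable =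
  least size? (G , connected , colorable⇒rainbowIndex G colorable , refl)
  where
  Index≤ : Graph n → Set
  Index≤ G = ∃[ c ] RainbowIndex G k c × c ≤ ℓ

  -- An index of at most `ℓ` exists exactly when some number of colours up to `ℓ` suffices, and this
  -- is a bounded search. The search bound is strict, hence `suc ℓ`.
  index≤? : ∀ G → Dec (Index≤ G)
  index≤? G = map′
    (λ (c , c≤ℓ , p) → let j , min , j≤c = colorable⇒rainbowIndex G p in j , min , ℕ.≤-trans j≤c (s≤s⁻¹ c≤ℓ))
    (λ (c , (p , _) , c≤ℓ) → c , s≤s c≤ℓ , p)
    (ℕ.anyUpTo? (colorable? G k) (suc ℓ))

  size? : ∀ m → Dec (∃ λ (G : Graph n) → Connected G × Index≤ G × size G ≡ m)
  size? m = searchGraph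
    (λ {G} {H} G≈H (connected , (c , (p , min) , c≤ℓ) , size≡) →
      (λ u v → Star.map (≈-adj G≈H) (connected u v)) ,
      (c , (≈-colorable G≈H p , λ j q → min j (≈-colorable (≈-sym G≈H) q)) , c≤ℓ) ,
      trans (sym (≈-size G≈H)) size≡)
    (λ G → connected? G ×-dec index≤? G ×-dec size G ℕ.≟ m)

-- Rainbow trees

T-does⁻ : ∀ {P : Set} (P? : Dec P) → T (does P?) → P
T-does⁻ (yes p) _ = p

T-does⁺ : ∀ {P : Set} (P? : Dec P) → P → T (does P?)
T-does⁺ (yes _) _ = tt
T-does⁺ (no ¬p) p = contradiction p ¬p

module FromRelation {n} {R : Rel (Fin n) 0ℓ} (R? : Decidable₂ R)
                    (R-sym : Symmetric R) (R-irrefl : ∀ u → ¬ R u u) where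

  fromRelation : Graph n
  fromRelation = record
    { adj    = λ u v → does (R? u v)
    ; sym    = λ u v → does-⇔ (mk⇔ R-sym R-sym) (R? u v) (R? v u)
    ; irrefl = λ u → dec-false (R? u u) (R-irrefl u)
    }

  adj⁻ : ∀ {u v} → Adj fromRelation u v → R u v
  adj⁻ = T-does⁻ (R? _ _)

  adj⁺ : ∀ {u v} → R u v → Adj fromRelation u v
  adj⁺ = T-does⁺ (R? _ _)

-- Cycles and leaves

module _ {A : Set} {R : Rel A 0ℓ} where

  linked-∷ʳ : ∀ ws {u v} → Linked R (ws ∷ʳ u) → R u v → Linked R ((ws ∷ʳ u) ∷ʳ v)
  linked-∷ʳ []           _        r = r ∷ [-]
  linked-∷ʳ (w ∷ [])     (r′ ∷ l) r = r′ ∷ linked-∷ʳ [] l r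
  linked-∷ʳ (w ∷ x ∷ ws) (r′ ∷ l) r = r′ ∷ linked-∷ʳ (x ∷ ws) l r

  linked-last : ∀ w ws {x} → Linked R (w ∷ (ws ∷ʳ x)) → ∃ λ z → z ∈ w ∷ ws × R z x
  linked-last w []       (r ∷ _) = w , here refl , r
  linked-last w (y ∷ ws) (_ ∷ l) = let z , z∈ , r = linked-last y ws l in z , there z∈ , r

  linked-map-All : ∀ {P : A → Set} {Q : Rel A 0ℓ} → (∀ {u v} → P u → P v → R u v → Q u v) →
                   ∀ {ws} → All P ws → Linked R ws → Linked Q ws
  linked-map-All f _              []      = []
  linked-map-All f _              [-]     = [-]
  linked-map-All f (p ∷ ps@(q ∷ _)) (r ∷ l) = f p q r ∷ linked-map-All f ps l

module _ {n} (G : Graph n) where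

  -- Moves the base point one step along the cycle; repeated use brings any vertex of the cycle to
  -- the front.
  rotate : ∀ {u v vs} → IsCycle G u (v ∷ vs) → IsCycle G v (vs ∷ʳ u)
  rotate {u} {v} {vs} (len , unique , u~v ∷ linked) =
    subst (2 ≤_) (length-++-comm [ u ] vs) len ,
    Unique-resp-↭ (∷↭∷ʳ u (v ∷ vs)) unique ,
    linked-∷ʳ (v ∷ vs) linked u~v
    where open Permutation (setoid (Fin n)) using (Unique-resp-↭; ∷↭∷ʳ)

  module _ {x y} (leaf : ∀ {w} → Adj G x w → w ≡ y) where

    private
      G-sym : ∀ {u v} → Adj G u v → Adj G v u
      G-sym = subst T (Graph.sym G _ _)

    -- The vertices after and before `x` on the cycle are distinct, yet both are neighbours of the
    -- leaf and so equal `y`.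
    leaf-∉-start : ∀ vs → ¬ IsCycle G x vs
    leaf-∉-start (v ∷ [])     (s≤s () , _)
    leaf-∉-start (v ∷ w ∷ ws) (_ , _ ∷ v≢ ∷ _ , x~v ∷ _ ∷ linked) =
      let z , z∈ , z~x = linked-last w ws linked in
      All.lookup v≢ z∈ (trans (leaf x~v) (sym (leaf (G-sym z~x))))

    leaf-∉-cycle : ∀ us {u ws} → ¬ IsCycle G u (us ++ x ∷ ws)
    leaf-∉-cycle []       cycle = leaf-∉-start _ (rotate cycle)
    leaf-∉-cycle (v ∷ us) {u} {ws} cycle =
      leaf-∉-cycle us (subst (IsCycle G v) (++-assoc us (x ∷ ws) [ u ]) (rotate cycle))

    cycle-avoids-leaf : ∀ {u vs} → IsCycle G u vs → x ∉ u ∷ vs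
    cycle-avoids-leaf cycle (here refl) = leaf-∉-start _ cycle
    cycle-avoids-leaf cycle (there x∈vs) with us , _ , refl ← ∈-∃++ x∈vs = leaf-∉-cycle us cycle

-- Growing rainbow trees by pendant edges

module _ {n c : ℕ} {G : Graph n} (χ : EdgeColoring G c) where

  -- The list `vs` has exactly the vertices of the tree, while `cs` need only contain all its
  -- colours. Freshness of a vertex or colour can thus be checked on explicit lists.
  record RainbowTree (vs : List (Fin n)) (cs : List (Fin c)) : Set where
    field
      subgraph  : Subgraph G
      isTree    : IsTree subgraph
      isRainbow : IsRainbow χ subgraph
      verts⁺    : ∀ {v} → v ∈ vs → v ∈ₛ verts subgraph
      verts⁻    : ∀ {v} → v ∈ₛ verts subgraph → v ∈ vs
      colors    : ∀ {u v} → Adj (graph subgraph) u v → color χ u v ∈ cs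

  open RainbowTree

  root : ∀ r → RainbowTree [ r ] []
  root r = record
    { subgraph  = record { verts = ⁅ r ⁆ ; graph = edgeless ; sub = λ () ; incident = λ () }
    ; isTree    = (λ u∈ v∈ → subst (Star _ _) (trans (x∈⁅y⁆⇒x≡y r u∈) (sym (x∈⁅y⁆⇒x≡y r v∈))) ε)
                , (λ { u (v ∷ vs) (_ , _ , () ∷ _) })
    ; isRainbow = λ ()
    ; verts⁺    = λ { (here refl) → x∈⁅x⁆ r }
    ; verts⁻    = λ v∈ → here (x∈⁅y⁆⇒x≡y r v∈)
    ; colors    = λ ()
    }
    where
    edgeless : Graph n
    edgeless = record { adj = λ _ _ → false ; sym = λ _ _ → refl ; irrefl = λ _ → refl }

  module _ {vs cs} (H : RainbowTree vs cs) {x y} (y∈ : y ∈ vs) (x∉ : All (x ≢_) vs)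
           (x~y : Adj G x y) (new : All (color χ x y ≢_) cs) where

    private
      V = verts (subgraph H)
      E = graph (subgraph H)

      x∉V : ¬ x ∈ₛ V
      x∉V x∈ = All.lookup x∉ (verts⁻ H x∈) refl

      y∈V : y ∈ₛ V
      y∈V = verts⁺ H y∈

      Pendant : Fin n → Fin n → Set
      Pendant u v = (u ≡ x × v ≡ y) ⊎ (u ≡ y × v ≡ x)

      incident : ∀ {u v} → Adj E u v → u ∈ₛ V × v ∈ₛ V
      incident = Subgraph.incident (subgraph H)

      y≢x : y ≢ x
      y≢x refl = x∉V y∈V

      pendant-sym : Symmetric Pendant
      pendant-sym = λ { (inj₁ (p , q)) → inj₂ (q , p) ; (inj₂ (p , q)) → inj₁ (q , p) }

      extended-irrefl : ∀ u → ¬ (Adj E u u ⊎ Pendant u u)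
      extended-irrefl u (inj₁ e)                   = subst T (Graph.irrefl E u) e
      extended-irrefl u (inj₂ (inj₁ (refl , x≡y))) = y≢x (sym x≡y)
      extended-irrefl u (inj₂ (inj₂ (refl , y≡x))) = y≢x y≡x

      open FromRelation {R = λ u v → Adj E u v ⊎ Pendant u v}
        (λ u v → adj? E u v ⊎-dec (u ≟ x ×-dec v ≟ y) ⊎-dec (u ≟ y ×-dec v ≟ x))
        (Sum.map (subst T (Graph.sym E _ _)) pendant-sym)
        extended-irrefl
        renaming (fromRelation to E⁺)

      leaf : ∀ {w} → Adj E⁺ x w → w ≡ y
      leaf e with adj⁻ e
      ... | inj₁ e′                = contradiction (proj₁ (incident e′)) x∉V
      ... | inj₂ (inj₁ (_ , w≡y))  = w≡y
      ... | inj₂ (inj₂ (x≡y , _))  = contradiction (sym x≡y) y≢x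

      old : ∀ {u v} → x ≢ u → x ≢ v → Adj E⁺ u v → Adj E u v
      old x≢u x≢v e with adj⁻ e
      ... | inj₁ e′               = e′
      ... | inj₂ (inj₁ (u≡x , _)) = contradiction (sym u≡x) x≢u
      ... | inj₂ (inj₂ (_ , v≡x)) = contradiction (sym v≡x) x≢v

      -- A cycle avoids the leaf `x`, so all its edges are old and it would already be a cycle in
      -- `E`.
      acyclic : Acyclic E⁺
      acyclic u vs cycle@(len , unique , linked) =
        proj₂ (isTree H) u vs (len , unique , linked-map-All old avoids linked)
        where
        avoids : All (x ≢_) (u ∷ (vs ∷ʳ u))
        avoids with x≢u ∷ x≢vs ← All.¬Any⇒All¬ _ (cycle-avoids-leaf E⁺ leaf cycle) =
          x≢u ∷ All.++⁺ x≢vs (x≢u ∷ [])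

      pendant-color : ∀ {u v} → Pendant u v → color χ u v ≡ color χ x y
      pendant-color (inj₁ (refl , refl)) = refl
      pendant-color (inj₂ (refl , refl)) = sym (EdgeColoring.sym χ x~y)

      fresh : ∀ {u v p q} → Adj E u v → Pendant p q → color χ u v ≢ color χ p q
      fresh e pend eq = All.lookup new (colors H e) (sym (trans eq (pendant-color pend)))

      rainbow : ∀ {u v p q} → Adj E⁺ u v → Adj E⁺ p q → color χ u v ≡ color χ p q →
                (u ≡ p × v ≡ q) ⊎ (u ≡ q × v ≡ p)
      rainbow e e′ eq with adj⁻ e | adj⁻ e′
      ... | inj₁ a | inj₁ b = isRainbow H a b eq
      ... | inj₁ a | inj₂ b = contradiction eq (fresh a b)
      ... | inj₂ a | inj₁ b = contradiction (sym eq) (fresh b a)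
      ... | inj₂ (inj₁ (refl , refl)) | inj₂ (inj₁ (refl , refl)) = inj₁ (refl , refl)
      ... | inj₂ (inj₁ (refl , refl)) | inj₂ (inj₂ (refl , refl)) = inj₂ (refl , refl)
      ... | inj₂ (inj₂ (refl , refl)) | inj₂ (inj₁ (refl , refl)) = inj₂ (refl , refl)
      ... | inj₂ (inj₂ (refl , refl)) | inj₂ (inj₂ (refl , refl)) = inj₁ (refl , refl)

      V⁺ = V ∪ ⁅ x ⁆

      to-y : ∀ {u} → u ∈ₛ V⁺ → Star (Adj E⁺) u y
      to-y u∈ with x∈p∪q⁻ V ⁅ x ⁆ u∈
      ... | inj₁ u∈V = Star.map (adj⁺ ∘ inj₁) (proj₁ (isTree H) u∈V y∈V)
      ... | inj₂ u∈x with refl ← x∈⁅y⁆⇒x≡y x u∈x = adj⁺ (inj₂ (inj₁ (refl , refl))) ◅ ε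

      V⊆ : ∀ {u} → u ∈ₛ V → u ∈ₛ V⁺
      V⊆ = p⊆p∪q ⁅ x ⁆

      x∈V⁺ : x ∈ₛ V⁺
      x∈V⁺ = q⊆p∪q V ⁅ x ⁆ (x∈⁅x⁆ x)

      sub⁺ : ∀ {u v} → Adj E⁺ u v → Adj G u v
      sub⁺ e with adj⁻ e
      ... | inj₁ e′                   = Subgraph.sub (subgraph H) e′
      ... | inj₂ (inj₁ (refl , refl)) = x~y
      ... | inj₂ (inj₂ (refl , refl)) = subst T (Graph.sym G _ _) x~y

      incident⁺ : ∀ {u v} → Adj E⁺ u v → u ∈ₛ V⁺ × v ∈ₛ V⁺
      incident⁺ e with adj⁻ e
      ... | inj₁ e′                   = let u∈ , v∈ = incident e′ in V⊆ u∈ , V⊆ v∈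
      ... | inj₂ (inj₁ (refl , refl)) = x∈V⁺ , V⊆ y∈V
      ... | inj₂ (inj₂ (refl , refl)) = V⊆ y∈V , x∈V⁺

    -- The new vertex is a leaf, so it closes no cycle and reaches the rest through `y`; its edge
    -- has a colour outside `cs`, so the tree stays rainbow.
    graft : RainbowTree (x ∷ vs) (color χ x y ∷ cs)
    graft = record
      { subgraph  = record { verts = V⁺ ; graph = E⁺ ; sub = sub⁺ ; incident = incident⁺ }
      ; isTree    = (λ u∈ v∈ → to-y u∈ ◅◅ Star.reverse (subst T (Graph.sym E⁺ _ _)) (to-y v∈)) , acyclic
      ; isRainbow = rainbow
      ; verts⁺    = λ { (here refl) → x∈V⁺ ; (there v∈) → V⊆ (verts⁺ H v∈) }
      ; verts⁻    = [ there ∘ verts⁻ H , here ∘ x∈⁅y⁆⇒x≡y x ]′ ∘ x∈p∪q⁻ V ⁅ x ⁆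
      ; colors    = [ there ∘ colors H , here ∘ pendant-color ]′ ∘ adj⁻
      }

-- The construction and its colouring

elements : ∀ {n} → Subset n → List (Fin n)
elements []            = []
elements (outside ∷ S) = map suc (elements S)
elements (inside  ∷ S) = zero ∷ map suc (elements S)

length-elements : ∀ {n} (S : Subset n) → length (elements S) ≡ ∣ S ∣
length-elements []            = refl
length-elements (outside ∷ S) = trans (length-map suc (elements S)) (length-elements S)
length-elements (inside  ∷ S) = cong suc (trans (length-map suc (elements S)) (length-elements S))

∈-elements : ∀ {n} {S : Subset n} {v} → v ∈ₛ S → v ∈ elements S
∈-elements {S = inside  ∷ S} {zero}  _             = here refl
∈-elements {S = inside  ∷ S} {suc v} (Vec.there v∈) = there (∈-map⁺ suc (∈-elements v∈))
∈-elements {S = outside ∷ S} {suc v} (Vec.there v∈) = ∈-map⁺ suc (∈-elements v∈)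

elements-increasing : ∀ {n} (S : Subset n) → AllPairs Fin._<_ (elements S)
elements-increasing []            = []
elements-increasing (outside ∷ S) = AllPairs.map⁺ (AllPairs.map s≤s (elements-increasing S))
elements-increasing (inside  ∷ S) =
  All.map⁺ (All.tabulate λ _ → s≤s z≤n) ∷ AllPairs.map⁺ (AllPairs.map s≤s (elements-increasing S))

even : ℕ → Bool
even zero    = true
even (suc n) = not (even n)

shade : Bool → Bool → Fin 3
shade true  true  = zero
shade false false = zero
shade true  false = suc zero
shade false true  = suc (suc zero)

-- Consecutive edges of a path share the middle parity `q`: two mixed edges in a row are of opposite
-- types, and a mixed edge never matches an unmixed one. Only three equal parities give a clash.
shade-injective : ∀ p q r → shade p q ≡ shade q r → p ≡ q × q ≡ r
shade-injective true  true  true  _ = refl , refl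
shade-injective false false false _ = refl , refl
shade-injective true  true  false ()
shade-injective true  false true  ()
shade-injective true  false false ()
shade-injective false true  true  ()
shade-injective false true  false ()
shade-injective false false true  ()

shade-diagonal : ∀ p → shade p p ≡ zero
shade-diagonal true  = refl
shade-diagonal false = refl

shade≡0⇒≡ : ∀ p q → shade p q ≡ zero → p ≡ q
shade≡0⇒≡ true  true  _ = refl
shade≡0⇒≡ false false _ = refl

module Construction (d N : ℕ) .{{_ : NonZero d}} where

  residue : Fin N → Fin d
  residue i = fromℕ< (m%n<n (toℕ i) d)

  level : Fin N → ℕ
  level i = toℕ i / d

  residue≡⇒%≡ : ∀ {i j} → residue i ≡ residue j → toℕ i % d ≡ toℕ j % d
  residue≡⇒%≡ eq = trans (sym (toℕ-fromℕ< _)) (trans (cong toℕ eq) (toℕ-fromℕ< _))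

  %≡⇒residue≡ : ∀ {i j} → toℕ i % d ≡ toℕ j % d → residue i ≡ residue j
  %≡⇒residue≡ eq = toℕ-injective (trans (toℕ-fromℕ< _) (trans eq (sym (toℕ-fromℕ< _))))

  residue-level-injective : ∀ {i j} → residue i ≡ residue j → level i ≡ level j → i ≡ j
  residue-level-injective {i} {j} r≡ l≡ = toℕ-injective (trans (m≡m%n+[m/n]*n (toℕ i) d)
    (trans (cong₂ (λ r l → r + l * d) (residue≡⇒%≡ r≡) l≡) (sym (m≡m%n+[m/n]*n (toℕ j) d))))

  -- The witness is `a + d`. In one class, `a < b` forces different levels, and equal parity then
  -- forces a gap of at least two, so `a + d` lies strictly below `b`.
  successor : ∀ {a b} → a Fin.< b → residue a ≡ residue b → even (level a) ≡ even (level b) →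
              ∃ λ x → a Fin.< x × x Fin.< b × residue x ≡ residue a × level x ≡ suc (level a)
  successor {a} {b} a<b r≡ e≡ = x , a<x , x<b , %≡⇒residue≡ x%d , x/d
    where
    a≤b : level a ≤ level b
    a≤b = /-monoˡ-≤ d (ℕ.<⇒≤ a<b)

    la<lb : level a < level b
    la<lb = ℕ.≤∧≢⇒< a≤b λ l≡ → ℕ.<-irrefl (cong toℕ (residue-level-injective r≡ l≡)) a<b

    1+la<lb : suc (level a) < level b
    1+la<lb = ℕ.≤∧≢⇒< la<lb λ l≡ → not-¬ refl (trans e≡ (cong even (sym l≡)))

    quotient : (toℕ a + d) / d ≡ suc (level a)
    quotient = trans (+-distrib-/-∣ʳ (toℕ a) ∣-refl) (trans (cong (level a +_) (n/n≡1 d)) (ℕ.+-comm _ 1))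

    a+d<b : toℕ a + d < toℕ b
    a+d<b = ℕ.≰⇒> λ b≤ → ℕ.<⇒≱ 1+la<lb (ℕ.≤-trans (/-monoˡ-≤ d b≤) (ℕ.≤-reflexive quotient))

    a+d<N : toℕ a + d < N
    a+d<N = ℕ.<-trans a+d<b (toℕ<n b)

    x : Fin N
    x = fromℕ< a+d<N

    toℕ-x : toℕ x ≡ toℕ a + d
    toℕ-x = toℕ-fromℕ< a+d<N

    x<b : x Fin.< b
    x<b = subst (_< toℕ b) (sym toℕ-x) a+d<b

    x/d : level x ≡ suc (level a)
    x/d = trans (cong (_/ d) toℕ-x) quotient

    x%d : toℕ x % d ≡ toℕ a % d
    x%d = trans (cong (_% d) toℕ-x) ([m+n]%n≡m%n (toℕ a) d)

    a<x : a Fin.< x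
    a<x = ℕ.≰⇒> λ x≤a → ℕ.<⇒≱ (ℕ.n<1+n (level a)) (subst (_≤ level a) x/d (/-monoˡ-≤ d x≤a))

  -- Here `zero` is the centre and `suc i` is the outer vertex `i`.
  Joined : Fin (suc N) → Fin (suc N) → Set
  Joined zero    zero    = ⊥
  Joined zero    (suc _) = ⊤
  Joined (suc _) zero    = ⊤
  Joined (suc i) (suc j) = i ≢ j × residue i ≡ residue j

  joined? : Decidable₂ Joined
  joined? zero    zero    = no λ ()
  joined? zero    (suc _) = yes _
  joined? (suc _) zero    = yes _
  joined? (suc i) (suc j) = ¬? (i ≟ j) ×-dec residue i ≟ residue j

  joined-sym : ∀ {u v} → Joined u v → Joined v u
  joined-sym {zero}  {suc _} _         = _
  joined-sym {suc _} {zero}  _         = _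
  joined-sym {suc _} {suc _} (i≢j , r≡) = ≢-sym i≢j , sym r≡

  joined-irrefl : ∀ u → ¬ Joined u u
  joined-irrefl (suc i) (i≢i , _) = i≢i refl

  open FromRelation {R = Joined} joined? (λ {u} {v} → joined-sym {u} {v}) joined-irrefl
    public using () renaming (fromRelation to G; adj⁻ to G-adj⁻; adj⁺ to G-adj⁺)

  connected : Connected G
  connected u v = to-centre u (from-centre v)
    where
    from-centre : ∀ v → Star (Adj G) zero v
    from-centre zero    = ε
    from-centre (suc i) = G-adj⁺ {zero} {suc i} tt ◅ ε

    to-centre : ∀ u → Star (Adj G) zero v → Star (Adj G) u v
    to-centre zero    s = s
    to-centre (suc i) s = G-adj⁺ {suc i} {zero} tt ◅ s

  -- The first three colours are reserved for clique edges; the other `d` belong to the residue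
  -- classes.
  spoke : Fin N → Fin (3 + d)
  spoke i = 3 ↑ʳ residue i

  -- Minimum and maximum make the colour symmetric although `shade` depends on the order of its
  -- arguments.
  link : Fin N → Fin N → Fin (3 + d)
  link i j = shade (even ((toℕ i ⊓ toℕ j) / d)) (even ((toℕ i ⊔ toℕ j) / d)) ↑ˡ d

  χ : EdgeColoring G (3 + d)
  χ = record { color = col ; sym = λ {u} {v} _ → col-sym u v }
    where
    col : Fin (suc N) → Fin (suc N) → Fin (3 + d)
    -- An arbitrary value: this pair is not an edge.
    col zero    zero    = zero
    col zero    (suc j) = spoke j
    col (suc i) zero    = spoke i
    col (suc i) (suc j) = link i j

    col-sym : ∀ u v → col u v ≡ col v u
    col-sym zero    zero    = refl
    col-sym zero    (suc j) = refl
    col-sym (suc i) zero    = refl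
    col-sym (suc i) (suc j) = cong₂ (λ m n → shade (even (m / d)) (even (n / d)) ↑ˡ d)
      (ℕ.⊓-comm (toℕ i) (toℕ j)) (ℕ.⊔-comm (toℕ i) (toℕ j))

  -- Rainbow trees in the construction

  shadeOf : Fin N → Fin N → Fin 3
  shadeOf i j = shade (even (level i)) (even (level j))

  -- The larger index comes first because the one-class trees below attach each later vertex to an
  -- earlier one.
  link-shade : ∀ {i j} → i Fin.< j → link j i ≡ shadeOf i j ↑ˡ d
  link-shade i<j = cong₂ (λ m n → shade (even (m / d)) (even (n / d)) ↑ˡ d)
    (ℕ.m≥n⇒m⊓n≡n (ℕ.<⇒≤ i<j)) (ℕ.m≥n⇒m⊔n≡m (ℕ.<⇒≤ i<j))

  link-≢ : ∀ {i j k l} → i Fin.< j → k Fin.< l → shadeOf i j ≢ shadeOf k l → link j i ≢ link l k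
  link-≢ i<j k<l s≢ eq = s≢ (↑ˡ-injective d _ _ (trans (sym (link-shade i<j)) (trans eq (link-shade k<l))))

  link≢spoke : ∀ i j k → link i j ≢ spoke k
  link≢spoke i j k = disjoint (shade (even ((toℕ i ⊓ toℕ j) / d)) (even ((toℕ i ⊔ toℕ j) / d)))
    where
    disjoint : ∀ (s : Fin 3) → s ↑ˡ d ≢ 3 ↑ʳ residue k
    disjoint (suc (suc zero)) ()

  spoke-≢ : ∀ {i j} → residue i ≢ residue j → spoke i ≢ spoke j
  spoke-≢ r≢ eq = r≢ (↑ʳ-injective 3 _ _ eq)

  -- The centre is always required, so that one tree serves a vertex set with or without the centre.
  Covered : List (Fin N) → Set
  Covered is = ∃₂ λ vs cs → RainbowTree χ vs cs × zero ∈ vs × All (λ i → suc i ∈ vs) is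

  ≢⇒suc≢ : ∀ {i j : Fin N} → i ≢ j → suc i ≢ suc j
  ≢⇒suc≢ i≢j = i≢j ∘ suc-injective

  joinSpoke : ∀ {vs cs} i → RainbowTree χ vs cs → zero ∈ vs → All (suc i ≢_) vs → All (spoke i ≢_) cs →
           RainbowTree χ (suc i ∷ vs) (spoke i ∷ cs)
  joinSpoke i H z∈ i∉ new = graft χ H z∈ i∉ (G-adj⁺ {suc i} {zero} tt) new

  joinLink : ∀ {vs cs} i j → RainbowTree χ vs cs → suc j ∈ vs → residue i ≡ residue j →
             All (suc i ≢_) vs → All (link i j ≢_) cs → RainbowTree χ (suc i ∷ vs) (link i j ∷ cs)
  joinLink i j H j∈ r≡ i∉ new =
    graft χ H j∈ i∉ (G-adj⁺ {suc i} {suc j} (All.lookup i∉ j∈ ∘ cong suc , r≡)) new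

  spoke₁ : ∀ a → RainbowTree χ (suc a ∷ zero ∷ []) (spoke a ∷ [])
  spoke₁ a = joinSpoke a (root χ zero) (here refl) ((λ ()) ∷ []) []

  spoke₂ : ∀ {a b} → residue a ≢ residue b → RainbowTree χ (suc b ∷ suc a ∷ zero ∷ []) (spoke b ∷ spoke a ∷ [])
  spoke₂ {a} {b} r≢ = joinSpoke b (spoke₁ a) (there (here refl))
    ((λ { refl → r≢ refl }) ∷ (λ ()) ∷ []) (spoke-≢ (≢-sym r≢) ∷ [])

  spoke-link : ∀ {a b} → a ≢ b → residue b ≡ residue a →
               RainbowTree χ (suc b ∷ suc a ∷ zero ∷ []) (link b a ∷ spoke a ∷ [])
  spoke-link {a} {b} a≢b r≡ = joinLink b a (spoke₁ a) (here refl) r≡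
    (≢⇒suc≢ (≢-sym a≢b) ∷ (λ ()) ∷ []) (link≢spoke b a a ∷ [])

  coverPair : ∀ {a b} → a ≢ b → Covered (a ∷ b ∷ [])
  coverPair {a} {b} a≢b with residue b ≟ residue a
  ... | yes r≡ = _ , _ , spoke-link a≢b r≡ , there (there (here refl)) , there (here refl) ∷ here refl ∷ []
  ... | no  r≢ = _ , _ , spoke₂ (≢-sym r≢) , there (there (here refl)) , there (here refl) ∷ here refl ∷ []

  -- The tree consists of the spokes to `a` and `c` and the clique edge between `a` and `b`.
  coverTwoClasses : ∀ {a b c} → a ≢ b → residue a ≡ residue b → residue c ≢ residue b → Covered (a ∷ b ∷ c ∷ [])
  coverTwoClasses {a} {b} {c} a≢b r≡ r≢ =
    _ , _ ,
    joinSpoke c (spoke-link a≢b (sym r≡)) (there (there (here refl)))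
      ((λ { refl → r≢ refl }) ∷ (λ { refl → r≢ r≡ }) ∷ (λ ()) ∷ [])
      (≢-sym (link≢spoke b a c) ∷ spoke-≢ (λ eq → r≢ (trans eq r≡)) ∷ []) ,
    there (there (there (here refl))) ,
    there (there (here refl)) ∷ there (here refl) ∷ here refl ∷ []

  coverThreeClasses : ∀ {a b c} → residue a ≢ residue b → residue a ≢ residue c → residue b ≢ residue c →
                      Covered (a ∷ b ∷ c ∷ [])
  coverThreeClasses {a} {b} {c} ab ac bc =
    _ , _ ,
    joinSpoke c (spoke₂ ab) (there (there (here refl)))
      ((λ { refl → bc refl }) ∷ (λ { refl → ac refl }) ∷ (λ ()) ∷ [])
      (spoke-≢ (≢-sym bc) ∷ spoke-≢ (≢-sym ac) ∷ []) ,
    there (there (there (here refl))) ,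
    there (there (here refl)) ∷ there (here refl) ∷ here refl ∷ []

  <⇒≢ : ∀ {i j : Fin N} → i Fin.< j → j ≢ i
  <⇒≢ i<i refl = ℕ.<-irrefl refl i<i

  coverOneClass : ∀ {a b c} → a Fin.< b → b Fin.< c → residue b ≡ residue a → residue c ≡ residue b →
                  Covered (a ∷ b ∷ c ∷ [])
  coverOneClass {a} {b} {c} a<b b<c ba cb
    with even (level a) ≟ᵇ even (level b) ×-dec even (level b) ≟ᵇ even (level c)
  -- The path centre, `a`, `b`, `c` works: its two clique edges differ because the parities do not
  -- all agree.
  ... | no varied =
    _ , _ ,
    joinLink c b (spoke-link (≢-sym (<⇒≢ a<b)) ba) (here refl) cb
      (≢⇒suc≢ (<⇒≢ b<c) ∷ ≢⇒suc≢ (<⇒≢ (ℕ.<-trans a<b b<c)) ∷ (λ ()) ∷ [])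
      (link-≢ b<c a<b (varied ∘ shade-injective _ _ _ ∘ sym) ∷ link≢spoke c b a ∷ []) ,
    there (there (there (here refl))) ,
    there (there (here refl)) ∷ there (here refl) ∷ here refl ∷ []
  -- Insert `x = a + d`, of the opposite parity. The edges of `a`, `x`, `b`, `c` then have the two
  -- mixed shades, one each, followed by the unmixed shade.
  ... | yes (a≡b , b≡c) with x , a<x , x<b , xa , lx ← successor a<b (sym ba) a≡b =
    _ , _ ,
    joinLink c b
      (joinLink b x (spoke-link (≢-sym (<⇒≢ a<x)) xa) (here refl) (trans ba (sym xa))
        (≢⇒suc≢ (<⇒≢ x<b) ∷ ≢⇒suc≢ (<⇒≢ a<b) ∷ (λ ()) ∷ [])
        (link-≢ x<b a<x (a≢x ∘ proj₁ ∘ shade-injective _ _ _ ∘ sym) ∷ link≢spoke b x a ∷ []))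
      (here refl) cb
      (≢⇒suc≢ (<⇒≢ b<c) ∷ ≢⇒suc≢ (<⇒≢ (ℕ.<-trans x<b b<c)) ∷ ≢⇒suc≢ (<⇒≢ (ℕ.<-trans a<b b<c)) ∷ (λ ()) ∷ [])
      (link-≢ b<c x<b (x≢b ∘ proj₁ ∘ shade-injective _ _ _ ∘ sym)
        ∷ link-≢ b<c a<x (a≢x ∘ constant) ∷ link≢spoke c b a ∷ []) ,
    there (there (there (there (here refl)))) ,
    there (there (there (here refl))) ∷ there (here refl) ∷ here refl ∷ []
    where
    a≢x : even (level a) ≢ even (level x)
    a≢x eq = not-¬ refl (trans eq (cong even lx))

    x≢b : even (level x) ≢ even (level b)
    x≢b eq = a≢x (trans a≡b (sym eq))

    constant : shadeOf b c ≡ shadeOf a x → even (level a) ≡ even (level x)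
    constant eq = shade≡0⇒≡ _ _ (trans (sym eq)
      (trans (cong (shade _) (sym b≡c)) (shade-diagonal (even (level b)))))

  coverTriple : ∀ {a b c} → a Fin.< b → b Fin.< c → Covered (a ∷ b ∷ c ∷ [])
  coverTriple {a} {b} {c} a<b b<c
    with residue b ≟ residue a | residue c ≟ residue b | residue a ≟ residue c
  ... | yes ba | yes cb | _      = coverOneClass a<b b<c ba cb
  ... | yes ba | no ¬cb | _      = coverTwoClasses (≢-sym (<⇒≢ a<b)) (sym ba) ¬cb
  -- The two-class tree is applied to a permuted triple, and the membership proofs are put back in
  -- order.
  ... | no ¬ba | yes cb | _
    with vs , cs , H , z∈ , b∈ ∷ c∈ ∷ a∈ ∷ [] ←
      coverTwoClasses (≢-sym (<⇒≢ b<c)) (sym cb) (λ ac → ¬ba (sym (trans ac cb))) =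
    vs , cs , H , z∈ , a∈ ∷ b∈ ∷ c∈ ∷ []
  ... | no ¬ba | no ¬cb | yes ac
    with vs , cs , H , z∈ , a∈ ∷ c∈ ∷ b∈ ∷ [] ←
      coverTwoClasses (≢-sym (<⇒≢ (ℕ.<-trans a<b b<c))) ac (≢-sym ¬cb) =
    vs , cs , H , z∈ , a∈ ∷ b∈ ∷ c∈ ∷ []
  ... | no ¬ba | no ¬cb | no ¬ac = coverThreeClasses (≢-sym ¬ba) ¬ac (≢-sym ¬cb)

  covered⇒rainbowTree : ∀ {s} {S : Subset N} → Covered (elements S) → ∃ (IsRainbowTree χ (s ∷ S))
  covered⇒rainbowTree (_ , _ , H , z∈ , is∈) =
    subgraph , isTree , isRainbow ,
    λ { {zero} _ → verts⁺ z∈ ; {suc i} (Vec.there i∈) → verts⁺ (All.lookup is∈ (∈-elements i∈)) }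
    where open RainbowTree H

  -- Two outer vertices remain when the centre belongs to the given triple, three when it does not.
  coverElements : ∀ (S : Subset N) → 2 ≤ ∣ S ∣ → ∣ S ∣ ≤ 3 → Covered (elements S)
  coverElements S 2≤ ≤3 rewrite sym (length-elements S) with elements S | elements-increasing S
  ... | a ∷ []             | _                             with s≤s () ← 2≤
  ... | a ∷ b ∷ []         | (a<b ∷ []) ∷ _                = coverPair (≢-sym (<⇒≢ a<b))
  ... | a ∷ b ∷ c ∷ []     | (a<b ∷ _) ∷ (b<c ∷ []) ∷ _    = coverTriple a<b b<c
  ... | _ ∷ _ ∷ _ ∷ _ ∷ _  | _                             with s≤s (s≤s (s≤s ())) ← ≤3

  χ-rainbow : IsRainbowColoring χ 3
  χ-rainbow (inside  ∷ S) eq = covered⇒rainbowTree (coverElements S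
    (ℕ.≤-reflexive (sym (ℕ.suc-injective eq))) (ℕ.≤-trans (ℕ.n≤1+n _) (ℕ.≤-reflexive eq)))
  χ-rainbow (outside ∷ S) eq = covered⇒rainbowTree (coverElements S
    (ℕ.≤-trans (ℕ.n≤1+n 2) (ℕ.≤-reflexive (sym eq))) (ℕ.≤-reflexive eq))

-- Counting the edges

Σ< : (ℕ → ℕ) → ℕ → ℕ
Σ< f n = sum (applyUpTo f n)

Σ<-last : ∀ f n → Σ< f (suc n) ≡ Σ< f n + f n
Σ<-last f n = trans (cong sum (sym (applyUpTo-∷ʳ f n)))
  (trans (sum-++ (applyUpTo f n) _) (cong (Σ< f n +_) (ℕ.+-identityʳ (f n))))

Σ<-ones : ∀ n → Σ< (λ _ → 1) n ≡ n
Σ<-ones zero    = refl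
Σ<-ones (suc n) = cong suc (Σ<-ones n)

bit : Bool → ℕ
bit true  = 1
bit false = 0

length-filter-tabulate : ∀ {A : Set} {P : A → Set} (P? : Decidable P) {n} (g : Fin n → A) (f : ℕ → Bool) →
  (∀ i → P (g i) → T (f (toℕ i))) → length (filter P? (tabulate g)) ≤ Σ< (bit ∘ f) n
length-filter-tabulate P? {zero}  g f P⇒f = z≤n
length-filter-tabulate P? {suc n} g f P⇒f with P? (g zero)
... | no  _ = ℕ.≤-trans (length-filter-tabulate P? (g ∘ suc) (f ∘ suc) (P⇒f ∘ suc)) (ℕ.m≤n+m _ _)
-- The value false is impossible, since `P⇒f zero p` would then inhabit the empty type.
... | yes p with true ← f 0 | _ ← P⇒f zero p = s≤s (length-filter-tabulate P? (g ∘ suc) (f ∘ suc) (P⇒f ∘ suc))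

length-filter-product : ∀ {A B : Set} {P : A × B → Set} (P? : Decidable P) {n} (g : Fin n → A) (ys : List B)
  (h : ℕ → ℕ) → (∀ i → length (filter P? (map (g i ,_) ys)) ≤ h (toℕ i)) →
  length (filter P? (cartesianProduct (tabulate g) ys)) ≤ Σ< h n
length-filter-product P? {zero}  g ys h row≤h = z≤n
length-filter-product P? {suc n} g ys h row≤h = begin
  length (filter P? (row ++ rest))                    ≡⟨ cong length (filter-++ P? row rest) ⟩
  length (filter P? row ++ filter P? rest)            ≡⟨ length-++ (filter P? row) ⟩
  length (filter P? row) + length (filter P? rest)    ≤⟨ ℕ.+-mono-≤ (row≤h zero)
                                                          (length-filter-product P? (g ∘ suc) ys (h ∘ suc) (row≤h ∘ suc)) ⟩
  Σ< h (suc n)                                        ∎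
  where
  open ℕ.≤-Reasoning
  row  = map (g zero ,_) ys
  rest = cartesianProduct (tabulate (g ∘ suc)) ys

-- Replaces the filtered list of edges by a double sum over natural numbers, on which the counting
-- is done by induction.
size≤ : ∀ {n} (G : Graph n) (f : ℕ → ℕ → Bool) →
        (∀ {u v} → u Fin.< v → Adj G u v → T (f (toℕ u) (toℕ v))) →
        size G ≤ Σ< (λ i → Σ< (bit ∘ f i) n) n
size≤ {n} G f adj⇒f = length-filter-product edge? id (allFin n) (λ i → Σ< (bit ∘ f i) n) λ u →
  subst (λ vs → length (filter edge? vs) ≤ Σ< (bit ∘ f (toℕ u)) n) (sym (map-tabulate id (u ,_)))
    (length-filter-tabulate edge? (u ,_) (f (toℕ u)) λ { v (u<v , e) → adj⇒f u<v e })
  where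
  edge? : Decidable λ (u , v) → u Fin.< v × Adj G u v
  edge? (u , v) = (u <? v) ×-dec adj? G u v

-- Pairs within a residue class

module _ (d : ℕ) .{{_ : NonZero d}} where

  %≡⇒∣∸ : ∀ {i j} → i % d ≡ j % d → d ∣ j ∸ i
  %≡⇒∣∸ {i} {j} eq = divides (j / d ∸ i / d)
    (trans (cong₂ _∸_ (trans (m≡m%n+[m/n]*n j d) (cong (_+ j / d * d) (sym eq))) (m≡m%n+[m/n]*n i d))
      (trans (ℕ.[m+n]∸[m+o]≡n∸o (i % d) (j / d * d) (i / d * d)) (sym (ℕ.*-distribʳ-∸ d (j / d) (i / d)))))

  -- Divisibility of the difference replaces equality of residues, so that increasing both arguments
  -- by one leaves the value unchanged by computation.
  inClass : ℕ → ℕ → Bool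
  inClass i j = (i <ᵇ j) ∧ does (d ∣? (j ∸ i))

  inClass⁺ : ∀ {i j} → i < j → i % d ≡ j % d → T (inClass i j)
  inClass⁺ {i} {j} i<j eq = Equivalence.from T-∧ (ℕ.<⇒<ᵇ i<j , T-does⁺ (d ∣? (j ∸ i)) (%≡⇒∣∸ eq))

  -- When `suc n` is a multiple `q * d`, the quotient of `n` is below `q`, so the quotient makes
  -- room for the newly counted multiple.
  multiples≤ : ∀ n → Σ< (λ j → bit (does (d ∣? suc j))) n ≤ n / d
  multiples≤ zero    = z≤n
  multiples≤ (suc n) rewrite Σ<-last (λ j → bit (does (d ∣? suc j))) n with d ∣? suc n
  ... | no  _ = ℕ.≤-trans (ℕ.≤-reflexive (ℕ.+-identityʳ _))
                  (ℕ.≤-trans (multiples≤ n) (/-monoˡ-≤ d (ℕ.n≤1+n n)))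
  ... | yes (divides q eq) = begin
    Σ< (λ j → bit (does (d ∣? suc j))) n + 1 ≤⟨ ℕ.+-monoˡ-≤ 1 (multiples≤ n) ⟩
    n / d + 1                                ≡⟨ ℕ.+-comm (n / d) 1 ⟩
    suc (n / d)                              ≤⟨ m<n*o⇒m/o<n {n = q} (ℕ.≤-reflexive eq) ⟩
    q                                        ≡⟨ m*n/n≡m q d ⟨
    q * d / d                                ≡⟨ cong (_/ d) eq ⟨
    suc n / d                                ∎
    where open ℕ.≤-Reasoning

  -- Deleting the element 0 shifts the other pairs, whose differences are unchanged.
  pairs≤ : ∀ n → Σ< (λ i → Σ< (bit ∘ inClass i) n) n ≤ Σ< (_/ d) n
  pairs≤ zero    = z≤n
  pairs≤ (suc n) = begin
    Σ< (λ j → bit (does (d ∣? suc j))) n + Σ< (λ i → Σ< (bit ∘ inClass i) n) n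
      ≤⟨ ℕ.+-mono-≤ (multiples≤ n) (pairs≤ n) ⟩
    n / d + Σ< (_/ d) n  ≡⟨ ℕ.+-comm (n / d) _ ⟩
    Σ< (_/ d) n + n / d  ≡⟨ Σ<-last (_/ d) n ⟨
    Σ< (_/ d) (suc n)    ∎
    where open ℕ.≤-Reasoning

  quotient : ∀ q {s} → s < d → (s + q * d) / d ≡ q
  quotient q {s} s<d = trans (+-distrib-/-∣ʳ s (divides q refl)) (cong₂ _+_ (m<n⇒m/n≡0 s<d) (m*n/n≡m q d))

  C2-suc : ∀ q → suc q C 2 ≡ q + q C 2
  C2-suc q = trans (sym (nCk+nC[k+1]≡[n+1]C[k+1] q 1)) (cong (_+ q C 2) (nC1≡n q))

  -- Each full block of `d` numbers contributes `d` times its common quotient, and these quotients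
  -- add up to `q C 2`; the partial block contributes `s * q`.
  Σ</ : ∀ q s → s ≤ d → Σ< (_/ d) (s + q * d) ≡ s * q + d * (q C 2)
  Σ</ zero    zero    _   = sym (ℕ.*-zeroʳ d)
  -- An empty block after `suc q` full ones is a block of length `d` after `q`; this is why `s` may
  -- equal `d`.
  Σ</ (suc q) zero    _   = trans (Σ</ q d ℕ.≤-refl)
    (trans (sym (ℕ.*-distribˡ-+ d q (q C 2))) (cong (d *_) (sym (C2-suc q))))
  Σ</ q       (suc s) s<d = begin
    Σ< (_/ d) (suc s + q * d)                  ≡⟨ Σ<-last (_/ d) (s + q * d) ⟩
    Σ< (_/ d) (s + q * d) + (s + q * d) / d    ≡⟨ cong₂ _+_ (Σ</ q s (ℕ.<⇒≤ s<d)) (quotient q s<d) ⟩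
    s * q + d * (q C 2) + q                    ≡⟨ ℕ.+-comm _ q ⟩
    q + (s * q + d * (q C 2))                  ≡⟨ ℕ.+-assoc q (s * q) _ ⟨
    suc s * q + d * (q C 2)                    ∎
    where open ≡-Reasoning

module _ (d N : ℕ) .{{_ : NonZero d}} where
  open Construction d N

  sizeG≤ : size G ≤ N + Σ< (_/ d) N
  sizeG≤ = begin
    size G                                                  ≤⟨ size≤ G joins G⇒joins ⟩
    -- The row of the centre counts the `N` spokes; its column is zero because edges are listed with
    -- `u < v`.
    Σ< (λ _ → 1) N + Σ< (λ i → Σ< (bit ∘ inClass d i) N) N  ≤⟨ ℕ.+-mono-≤ (ℕ.≤-reflexive (Σ<-ones N)) (pairs≤ d N) ⟩
    N + Σ< (_/ d) N                                         ∎
    where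
    open ℕ.≤-Reasoning

    joins : ℕ → ℕ → Bool
    joins zero    zero    = false
    joins zero    (suc _) = true
    joins (suc _) zero    = false
    joins (suc i) (suc j) = inClass d i j

    G⇒joins : ∀ {u v} → u Fin.< v → Adj G u v → T (joins (toℕ u) (toℕ v))
    G⇒joins {zero}  {suc j} _         _ = tt
    G⇒joins {suc i} {suc j} (s≤s i<j) e =
      let _ , r≡ = G-adj⁻ {suc i} {suc j} e in inClass⁺ d i<j (residue≡⇒%≡ r≡)

-- Comparison with the stated bound

module _ (d M : ℕ) .{{_ : NonZero d}} where

  private
    q = M / d
    r = M % d

    M≡ : M ≡ r + q * d
    M≡ = m≡m%n+[m/n]*n M d

  -- A positive remainder gives `M + (d ∸ 1) = (r ∸ 1) + (q + 1) * d`, with `r ∸ 1` still below `d`.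
  ceiling : ∀ {s} → r ≡ suc s → ⌈ M / d ⌉ ≡ suc q
  ceiling {s} r≡ =
    trans (cong (_/ d) M+d∸1) (quotient d (suc q) (ℕ.<-trans (subst (s <_) (sym r≡) (ℕ.n<1+n s)) (m%n<n M d)))
    where
    M+d∸1 : M + (d ∸ 1) ≡ s + suc q * d
    M+d∸1 = begin
      M + (d ∸ 1)                 ≡⟨ cong (_+ (d ∸ 1)) (trans M≡ (cong (_+ q * d) r≡)) ⟩
      suc (s + q * d) + (d ∸ 1)   ≡⟨ ℕ.+-suc (s + q * d) (d ∸ 1) ⟨
      s + q * d + suc (d ∸ 1)     ≡⟨ cong (s + q * d +_) (ℕ.suc-pred d) ⟩
      s + q * d + d               ≡⟨ ℕ.+-assoc s (q * d) d ⟩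
      s + (q * d + d)             ≡⟨ cong (s +_) (ℕ.+-comm (q * d) d) ⟩
      s + suc q * d               ∎
      where open ≡-Reasoning

  floor≤ceiling : q ≤ ⌈ M / d ⌉
  floor≤ceiling = /-monoˡ-≤ d (ℕ.m≤m+n M (d ∸ 1))

  -- For `r = 0` both sides vanish. Otherwise the ceiling is `suc q`, and Pascal's rule gives
  -- equality.
  ceilingC2 : (q + q C 2) * r ≤ (⌈ M / d ⌉ C 2) * r
  ceilingC2 with r in eq
  ... | zero  = ℕ.≤-reflexive (trans (ℕ.*-zeroʳ (q + q C 2)) (sym (ℕ.*-zeroʳ (⌈ M / d ⌉ C 2))))
  ... | suc s = ℕ.≤-reflexive (cong (_* suc s) (sym (trans (cong (_C 2) (ceiling eq)) (C2-suc d q))))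

  -- Of the first `M` outer vertices, `r` classes have size `q + 1` and `d ∸ r` have size `q`; the
  -- last vertex adds `q` more clique edges, absorbed by the ceiling. `X` stands for an upper bound
  -- on `d ∸ r`.
  bound : ∀ X → d ≤ r + X →
          suc M + Σ< (_/ d) (suc M) ≤ suc (suc M) + ⌈ M / d ⌉ + (⌈ M / d ⌉ C 2) * r + (q C 2) * X
  bound X d≤r+X = begin
    suc M + Σ< (_/ d) (suc M)                ≡⟨ cong (suc M +_) (trans (Σ<-last (_/ d) M) (cong (_+ q) Σ≡)) ⟩
    suc M + (r * q + d * c + q)              ≤⟨ ℕ.+-monoʳ-≤ (suc M) (ℕ.+-monoˡ-≤ q (ℕ.+-monoʳ-≤ (r * q)
                                                  (ℕ.*-monoˡ-≤ c d≤r+X))) ⟩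
    suc M + (r * q + (r + X) * c + q)        ≡⟨ regroup (suc M) r q c X ⟩
    suc M + q + (q + c) * r + c * X          ≤⟨ ℕ.+-monoˡ-≤ (c * X)
                                                  (ℕ.+-mono-≤ (ℕ.+-mono-≤ (ℕ.n≤1+n _) floor≤ceiling) ceilingC2) ⟩
    suc (suc M) + t + (t C 2) * r + c * X    ∎
    where
    open ℕ.≤-Reasoning
    t = ⌈ M / d ⌉
    c = q C 2
    Σ≡ : Σ< (_/ d) M ≡ r * q + d * c
    Σ≡ = trans (cong (Σ< (_/ d)) M≡) (Σ</ d q r (ℕ.<⇒≤ (m%n<n M d)))
    regroup : ∀ m r q c X → m + (r * q + (r + X) * c + q) ≡ m + q + (q + c) * r + c * X
    regroup = solve-∀

theorem2p11 : (n ℓ : ℕ) (7≤ℓ : 7 ≤ ℓ) (2ℓ≤n-1 : 2 * ℓ ≤ n ∸ 1) →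
    let q = ⌊ (n ∸ 2) / (ℓ ∸ 3) ⌋ {{ ℓ∸3-nonZero 7≤ℓ }}
        t = ⌈ (n ∸ 2) / (ℓ ∸ 3) ⌉ {{ ℓ∸3-nonZero 7≤ℓ }}
    in ∃[ m ] (MinimumSize n 3 ℓ m ×
         m ≤ n + t
             + (t C 2) * (n ∸ 2 ∸ q * (ℓ ∸ 3))
             + ((t + q ∸ t) C 2) * ((ℓ + 1 + q * (ℓ ∸ 3)) ∸ n))
-- Here `n = M + 2` and `ℓ = k + 4`, so `d = ℓ ∸ 3 = k + 1`; the graph has `M + 1` outer vertices
-- and its colouring uses `3 + d = ℓ` colours.
theorem2p11 (suc (suc M)) (suc (suc (suc (suc k)))) (s≤s (s≤s (s≤s (s≤s _)))) _ =
  let m , minimum , m≤ = minimumSize G connected (χ , χ-rainbow) in m , minimum , (begin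
    m                             ≤⟨ m≤ ⟩
    size G                        ≤⟨ sizeG≤ d (suc M) ⟩
    suc M + Σ< (_/ d) (suc M)     ≤⟨ bound d M X d≤r+X ⟩
    2 + M + t + (t C 2) * (M % d) + (q C 2) * X
      ≡⟨ cong₂ (λ r q′ → 2 + M + t + (t C 2) * r + (q′ C 2) * X) (m%n≡m∸m/n*n M d) (sym (ℕ.m+n∸m≡n t q)) ⟩
    2 + M + t + (t C 2) * (M ∸ q * d) + ((t + q ∸ t) C 2) * X ∎)
  where
  open ℕ.≤-Reasoning
  d = suc k
  open Construction d (suc M)
  q = M / d
  t = ⌈ M / d ⌉
  X = (4 + k + 1 + q * d) ∸ (2 + M)

  d≤r+X : d ≤ M % d + X
  d≤r+X = ℕ.+-cancelʳ-≤ (2 + q * d) d (M % d + X) (begin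
    -- The slack of 2 arises because `X` equals `d + 2 ∸ M % d`, while `d ∸ M % d` is enough.
    d + (2 + q * d)                    ≤⟨ ℕ.m≤n+m _ 2 ⟩
    2 + (d + (2 + q * d))              ≡⟨ shift k (q * d) ⟩
    4 + k + 1 + q * d                  ≤⟨ ℕ.m≤n+m∸n _ (2 + M) ⟩
    2 + M + X                          ≡⟨ cong (λ m → 2 + m + X) (m≡m%n+[m/n]*n M d) ⟩
    2 + (M % d + q * d) + X            ≡⟨ regroup (M % d) (q * d) X ⟩
    M % d + X + (2 + q * d)            ∎)
    where
    shift : ∀ k a → 2 + (suc k + (2 + a)) ≡ 4 + k + 1 + a
    shift = solve-∀
    regroup : ∀ r a X → 2 + (r + a) + X ≡ r + X + (2 + a)
    regroup = solve-∀
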